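{- Let $\mathcal{F}_m$ be a matrix-valued frieze (left or right) of period $p$ with entries $\mathfrak{M}_{i,j}$. 1. Transposing all the matrices in the non-trivial rows of $\mathcal{F}_m$ yields a new matrix-valued frieze, denoted $\mathcal{F}_m^{\ast}$. If $\mathcal{F}_m$ is a right matrix-valued frieze, then $\mathcal{F}_m^{\ast}$ is a left matrix-valued frieze. Hence if $\mathcal{F}_m$ is two-sided, then $\mathcal{F}_m^{\ast}$ is two-sided. 2. Assume that all the matrices of $\mathcal{F}_m$ commute with each other and let $x\in\mathbb{C}^l$ with $\|x\|=1$ be a common eigenvector of all matrices of $\mathcal{F}_m$. Then the array $\mathcal{F}_s(x)$ obtained by replacing each entry $A$ of $\mathcal{F}_m$ by the scalar $(Ax,x)_{\mathbb{C}^l}$ is a scalar frieze pattern with complex entries.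
   Context: Let $I$, $O$ be the $l\times l$ identity and zero matrices. A matrix-valued frieze of period $p$ (with $p-3$ non-trivial rows) is an array of $l\times l$ real matrices $\mathfrak{M}_{i,j}$, $i,j\in\mathbb{Z}$ with $i-2\le j\le i+p-2$, which is $p$-periodic ($\mathfrak{M}_{i+p,j+p}=\mathfrak{M}_{i,j}$), with $\mathfrak{M}_{i,i-2}=O=\mathfrak{M}_{i,i+p-2}$, $\mathfrak{M}_{i,i-1}=I=\mathfrak{M}_{i,i+p-3}$, and with $\mathfrak{M}_{i,j}\in GL_l(\mathbb{R})$ in the non-trivial rows $i\le j\le i+p-4$ (the row of index $d$ consists of the entries with $j-i=d$), satisfying one of the following rules. It is a left matrix-valued frieze if $$\mathfrak{M}_{i,j}\mathfrak{M}_{i+1,j+1}-\mathfrak{M}_{i,j+1}\mathfrak{M}_{i+1,j}=I$$ for all $i,j$ with $i-1\le j\le i+p-3$, a right matrix-valued frieze if $$\mathfrak{M}_{i+1,j+1}\mathfrak{M}_{i,j}-\mathfrak{M}_{i+1,j}\mathfrak{M}_{i,j+1}=I$$ for all such $i,j$, and two-sided if it is both left and right. A scalar frieze pattern with complex entries is an array of complex numbers $m_{i,j}$ of the same shape, with first and last rows ($j-i=-2$, $j-i=p-2$) consisting of $0$'s, second and next-to-last rows ($j-i=-1$, $j-i=p-3$) consisting of $1$'s, and satisfying the unimodular rule $m_{i,j}m_{i+1,j+1}-m_{i,j+1}m_{i+1,j}=1$ for all $i,j$ with $i-1\le j\le i+p-3$. $(\cdot,\cdot)_{\mathbb{C}^l}$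 is the standard Hermitian inner product. -}

module Defs where

open import Level using (0ℓ)
open import Algebra.Bundles using (CommutativeRing)
import Algebra.Properties.Semiring.Sum as SemiringSum
import Algebra.Properties.Ring as RingProperties
import Algebra.Properties.CommutativeSemigroup as SemigroupProperties
open import Data.Bool.Base using (if_then_else_)
import Data.Fin.Properties as Fin
open import Data.Integer.Base as ℤ using (ℤ; +_)
import Data.Integer.Properties as ℤ
open import Data.Nat.Base as ℕ using (ℕ)
import Data.Nat.Properties as ℕ
open import Data.Product using (∃; _×_; _,_; proj₁; proj₂)
open import Data.Rational.Base as ℚ using (ℚ; 0ℚ; 1ℚ; ½; ∣_∣)
import Data.Rational.Properties as ℚ
open import Data.Sum using (_⊎_)
open import Data.Vec.Functional using (Vector)
open import Relation.Binary.PropositionalEquality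
  using (_≡_; refl; sym; trans; cong; cong₂; subst; subst₂)
open import Relation.Nullary using (¬_; Dec; does)
open import Relation.Nullary.Decidable using (_×-dec_)

Eventually : (ℕ → Set) → Set
Eventually P = ∃ λ N → ∀ n → N ℕ.≤ n → P n

IsCauchy : (ℕ → ℚ) → Set
IsCauchy x = ∀ ε → 0ℚ ℚ.< ε →
  ∃ λ N → ∀ m n → N ℕ.≤ m → N ℕ.≤ n → ∣ x m ℚ.- x n ∣ ℚ.< ε

-- A Cauchy sequence of rationals; the real number it represents is its class under _≈ℝ_.
record ℝ : Set where
  no-eta-equality
  field
    seq    : ℕ → ℚ
    cauchy : IsCauchy seq

open ℝ public

infix 4 _≈ℝ_ _≤ℝ_

record _≈ℝ_ (x y : ℝ) : Set where
  no-eta-equality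
  constructor mk≈
  field
    close : ∀ ε → 0ℚ ℚ.< ε → Eventually λ n → ∣ seq x n ℚ.- seq y n ∣ ℚ.< ε

record _≤ℝ_ (x y : ℝ) : Set where
  no-eta-equality
  constructor mk≤
  field
    below : ∀ ε → 0ℚ ℚ.< ε → Eventually λ n → seq x n ℚ.< seq y n ℚ.+ ε

open _≈ℝ_ public
open _≤ℝ_ public

private
  module Differences {c ℓ} (R : CommutativeRing c ℓ) where
    open CommutativeRing R renaming (refl to ≈-refl; sym to ≈-sym)
    open RingProperties ring using (//-rightDividesˡ; ⁻¹-anti-homo-//; -‿+-comm; x[y-z]≈xy-xz)
    open SemigroupProperties +-commutativeSemigroup using (interchange)
    open import Relation.Binary.Reasoning.Setoid setoid

    flip-difference : ∀ a b → - (a - b) ≈ b - a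
    flip-difference = ⁻¹-anti-homo-//

    neg-difference : ∀ a b → b - a ≈ - a - - b
    neg-difference a b = begin
      b - a        ≈⟨ flip-difference a b ⟨
      - (a - b)    ≈⟨ -‿+-comm a (- b) ⟨
      - a - - b    ∎

    add-back : ∀ a b → (a - b) + b ≈ a
    add-back a b = //-rightDividesˡ b a

    telescope : ∀ a b c → (a - b) + (b - c) ≈ a - c
    telescope a b c = begin
      (a - b) + (b - c)  ≈⟨ +-assoc (a - b) b (- c) ⟨
      ((a - b) + b) - c  ≈⟨ +-congʳ (add-back a b) ⟩
      a - c              ∎

    sum-difference : ∀ a a′ b b′ → (a - a′) + (b - b′) ≈ (a + b) - (a′ + b′)
    sum-difference a a′ b b′ = begin
      (a - a′) + (b - b′)      ≈⟨ interchange a (- a′) b (- b′) ⟩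
      (a + b) + (- a′ + - b′)  ≈⟨ +-congˡ (-‿+-comm a′ b′) ⟩
      (a + b) - (a′ + b′)      ∎

    product-difference : ∀ a a′ b b′ →
      a * (b - b′) + b′ * (a - a′) ≈ a * b - a′ * b′
    product-difference a a′ b b′ = begin
      a * (b - b′) + b′ * (a - a′)             ≈⟨ +-cong (x[y-z]≈xy-xz a b b′) (x[y-z]≈xy-xz b′ a a′) ⟩
      (a * b - a * b′) + (b′ * a - b′ * a′)    ≈⟨ +-congˡ (+-cong (*-comm b′ a) (-‿cong (*-comm b′ a′))) ⟩
      (a * b - a * b′) + (a * b′ - a′ * b′)    ≈⟨ telescope (a * b) (a * b′) (a′ * b′) ⟩
      a * b - a′ * b′                          ∎

  open Differences ℚ.+-*-commutativeRing

  Bounded : (ℕ → ℚ) → Set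
  Bounded x = ∃ λ B → 0ℚ ℚ.< B × Eventually λ n → ∣ x n ∣ ℚ.< B

  0<½* : ∀ {ε} → 0ℚ ℚ.< ε → 0ℚ ℚ.< ½ ℚ.* ε
  0<½* {ε} 0<ε = subst (ℚ._< ½ ℚ.* ε) (ℚ.*-zeroʳ ½) (ℚ.*-monoʳ-<-pos ½ 0<ε)

  halves : ∀ ε → ½ ℚ.* ε ℚ.+ ½ ℚ.* ε ≡ ε
  halves ε = trans (sym (ℚ.*-distribʳ-+ ε ½ ½)) (ℚ.*-identityˡ ε)

  ∣p-p∣<ε : ∀ p {ε} → 0ℚ ℚ.< ε → ∣ p ℚ.- p ∣ ℚ.< ε
  ∣p-p∣<ε p {ε} = subst (λ q → ∣ q ∣ ℚ.< ε) (sym (ℚ.+-inverseʳ p))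

  ∣p-q∣≡∣q-p∣ : ∀ p q → ∣ p ℚ.- q ∣ ≡ ∣ q ℚ.- p ∣
  ∣p-q∣≡∣q-p∣ p q = trans (sym (ℚ.∣-p∣≡∣p∣ (p ℚ.- q)))
    (cong ∣_∣ (flip-difference p q))

  ∣+∣-bound : ∀ {p q δ η} → ∣ p ∣ ℚ.< δ → ∣ q ∣ ℚ.< η → ∣ p ℚ.+ q ∣ ℚ.< δ ℚ.+ η
  ∣+∣-bound {p} {q} p< q< = ℚ.≤-<-trans (ℚ.∣p+q∣≤∣p∣+∣q∣ p q) (ℚ.+-mono-< p< q<)

  ∣*∣-bound : ∀ {p q B δ} → 0ℚ ℚ.< B → ∣ p ∣ ℚ.< B → ∣ q ∣ ℚ.< δ →
              ∣ p ℚ.* q ∣ ℚ.< B ℚ.* δ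
  ∣*∣-bound {p} {q} {B} {δ} 0<B p< q< = subst (ℚ._< B ℚ.* δ) (sym (ℚ.∣p*q∣≡∣p∣*∣q∣ p q))
    (ℚ.≤-<-trans
      (ℚ.*-monoʳ-≤-nonNeg ∣ q ∣ {{ℚ.∣-∣-nonNeg q}} (ℚ.<⇒≤ p<))
      (ℚ.*-monoʳ-<-pos B {{ℚ.positive 0<B}} q<))

  +-close : ∀ {a a′ b b′ ε} → ∣ a ℚ.- a′ ∣ ℚ.< ½ ℚ.* ε → ∣ b ℚ.- b′ ∣ ℚ.< ½ ℚ.* ε →
            ∣ (a ℚ.+ b) ℚ.- (a′ ℚ.+ b′) ∣ ℚ.< ε
  +-close {a} {a′} {b} {b′} {ε} p q = subst₂ ℚ._<_
    (cong ∣_∣ (sum-difference a a′ b b′))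
    (halves ε)
    (∣+∣-bound {a ℚ.- a′} {b ℚ.- b′} p q)

  trans-close : ∀ {a b c ε} → ∣ a ℚ.- b ∣ ℚ.< ½ ℚ.* ε → ∣ b ℚ.- c ∣ ℚ.< ½ ℚ.* ε →
                ∣ a ℚ.- c ∣ ℚ.< ε
  trans-close {a} {b} {c} {ε} p q = subst₂ ℚ._<_
    (cong ∣_∣ (telescope a b c))
    (halves ε)
    (∣+∣-bound {a ℚ.- b} {b ℚ.- c} p q)

  -- The tolerance in the factors that gives tolerance ε in a product of terms below B.
  tolerance : ∀ B ε → 0ℚ ℚ.< B → 0ℚ ℚ.< ε → ∃ λ δ → 0ℚ ℚ.< δ × B ℚ.* δ ≡ ½ ℚ.* ε
  tolerance B ε 0<B 0<ε = B⁻¹ ℚ.* (½ ℚ.* ε) , 0<δ , eq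
    where
    instance
      B-pos = ℚ.positive 0<B
      B-nonZero = ℚ.pos⇒nonZero B
    B⁻¹ = ℚ.1/ B
    0<δ : 0ℚ ℚ.< B⁻¹ ℚ.* (½ ℚ.* ε)
    0<δ = subst (ℚ._< B⁻¹ ℚ.* (½ ℚ.* ε)) (ℚ.*-zeroʳ B⁻¹)
      (ℚ.*-monoʳ-<-pos B⁻¹ {{ℚ.1/pos⇒pos B}} (0<½* 0<ε))
    eq : B ℚ.* (B⁻¹ ℚ.* (½ ℚ.* ε)) ≡ ½ ℚ.* ε
    eq = trans (sym (ℚ.*-assoc B B⁻¹ (½ ℚ.* ε)))
      (trans (cong (ℚ._* (½ ℚ.* ε)) (ℚ.*-inverseʳ B)) (ℚ.*-identityˡ (½ ℚ.* ε)))

  *-close : ∀ {a a′ b b′ B δ ε} → 0ℚ ℚ.< B → B ℚ.* δ ≡ ½ ℚ.* ε →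
            ∣ a ∣ ℚ.< B → ∣ b′ ∣ ℚ.< B → ∣ a ℚ.- a′ ∣ ℚ.< δ → ∣ b ℚ.- b′ ∣ ℚ.< δ →
            ∣ (a ℚ.* b) ℚ.- (a′ ℚ.* b′) ∣ ℚ.< ε
  *-close {a} {a′} {b} {b′} {B} {δ} {ε} 0<B eq a< b′< p q = subst₂ ℚ._<_
    (cong ∣_∣ (product-difference a a′ b b′))
    (trans (cong₂ ℚ._+_ eq eq) (halves ε))
    (∣+∣-bound {a ℚ.* (b ℚ.- b′)} {b′ ℚ.* (a ℚ.- a′)}
      (∣*∣-bound {a} {b ℚ.- b′} 0<B a< q) (∣*∣-bound {b′} {a ℚ.- a′} 0<B b′< p))

  cauchy⇒bounded : ∀ {x} → IsCauchy x → Bounded x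
  cauchy⇒bounded {x} c with c 1ℚ (ℚ.positive⁻¹ 1ℚ)
  ... | N , h = 1ℚ ℚ.+ (∣ x N ∣ ℚ.+ 1ℚ) , 0<B , N , bound
    where
    xN< : ∣ x N ∣ ℚ.< ∣ x N ∣ ℚ.+ 1ℚ
    xN< = subst (ℚ._< ∣ x N ∣ ℚ.+ 1ℚ) (ℚ.+-identityʳ ∣ x N ∣)
      (ℚ.+-monoʳ-< ∣ x N ∣ (ℚ.positive⁻¹ 1ℚ))
    0<B : 0ℚ ℚ.< 1ℚ ℚ.+ (∣ x N ∣ ℚ.+ 1ℚ)
    0<B = ℚ.+-mono-< (ℚ.positive⁻¹ 1ℚ) (ℚ.≤-<-trans (ℚ.0≤∣p∣ (x N)) xN<)
    bound : ∀ n → N ℕ.≤ n → ∣ x n ∣ ℚ.< 1ℚ ℚ.+ (∣ x N ∣ ℚ.+ 1ℚ)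
    bound n N≤n = subst (λ q → ∣ q ∣ ℚ.< 1ℚ ℚ.+ (∣ x N ∣ ℚ.+ 1ℚ))
      (add-back (x n) (x N))
      (∣+∣-bound {x n ℚ.- x N} {x N} (h n N N≤n ℕ.≤-refl) xN<)

  bounded₂ : ∀ {x y} → Bounded x → Bounded y →
             ∃ λ B → 0ℚ ℚ.< B × Eventually λ n → ∣ x n ∣ ℚ.< B × ∣ y n ∣ ℚ.< B
  bounded₂ (B , 0<B , N , h) (C , 0<C , M , k) =
    B ℚ.+ C , ℚ.+-mono-< 0<B 0<C , N ℕ.⊔ M , λ n le →
      ℚ.<-trans (h n (ℕ.m⊔n≤o⇒m≤o N M le))
        (subst (ℚ._< B ℚ.+ C) (ℚ.+-identityʳ B) (ℚ.+-monoʳ-< B 0<C)) ,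
      ℚ.<-trans (k n (ℕ.m⊔n≤o⇒n≤o N M le))
        (subst (ℚ._< B ℚ.+ C) (ℚ.+-identityˡ C) (ℚ.+-monoˡ-< C 0<B))

private
  abstract
    constant-cauchy : ∀ q → IsCauchy (λ _ → q)
    constant-cauchy q ε 0<ε = 0 , λ _ _ _ _ → ∣p-p∣<ε q 0<ε

    +-cauchy : ∀ {x y} → IsCauchy x → IsCauchy y → IsCauchy (λ n → x n ℚ.+ y n)
    +-cauchy {x} {y} cx cy ε 0<ε
      with N , h ← cx _ (0<½* 0<ε) | M , k ← cy _ (0<½* 0<ε)
      = N ℕ.⊔ M , λ m n p q →
        +-close {x m} {x n} {y m} {y n}
          (h m n (ℕ.m⊔n≤o⇒m≤o N M p) (ℕ.m⊔n≤o⇒m≤o N M q))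
          (k m n (ℕ.m⊔n≤o⇒n≤o N M p) (ℕ.m⊔n≤o⇒n≤o N M q))

    neg-cauchy : ∀ {x} → IsCauchy x → IsCauchy (λ n → ℚ.- x n)
    neg-cauchy {x} cx ε 0<ε with N , h ← cx ε 0<ε = N , λ m n p q →
      subst (ℚ._< ε) (cong ∣_∣ (neg-difference (x m) (x n))) (h n m q p)

    *-cauchy : ∀ {x y} → IsCauchy x → IsCauchy y → IsCauchy (λ n → x n ℚ.* y n)
    *-cauchy {x} {y} cx cy ε 0<ε
      with B , 0<B , L , b ← bounded₂ (cauchy⇒bounded cx) (cauchy⇒bounded cy)
      with δ , 0<δ , eq ← tolerance B ε 0<B 0<ε
      with N , h ← cx δ 0<δ | M , k ← cy δ 0<δ
      = L ℕ.⊔ (N ℕ.⊔ M) , λ m n p q →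
        let p′ = ℕ.m⊔n≤o⇒n≤o L (N ℕ.⊔ M) p
            q′ = ℕ.m⊔n≤o⇒n≤o L (N ℕ.⊔ M) q
        in *-close {x m} {x n} {y m} {y n} 0<B eq
             (proj₁ (b m (ℕ.m⊔n≤o⇒m≤o L (N ℕ.⊔ M) p)))
             (proj₂ (b n (ℕ.m⊔n≤o⇒m≤o L (N ℕ.⊔ M) q)))
             (h m n (ℕ.m⊔n≤o⇒m≤o N M p′) (ℕ.m⊔n≤o⇒m≤o N M q′))
             (k m n (ℕ.m⊔n≤o⇒n≤o N M p′) (ℕ.m⊔n≤o⇒n≤o N M q′))

infixl 6 _+ℝ_
infixl 7 _*ℝ_
infix  8 -ℝ_

ofℚ : ℚ → ℝ
seq    (ofℚ q) _ = q
cauchy (ofℚ q)   = constant-cauchy q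

0ℝ 1ℝ : ℝ
0ℝ = ofℚ 0ℚ
1ℝ = ofℚ 1ℚ

_+ℝ_ _*ℝ_ : ℝ → ℝ → ℝ
seq    (x +ℝ y) n = seq x n ℚ.+ seq y n
cauchy (x +ℝ y)   = +-cauchy {seq x} {seq y} (cauchy x) (cauchy y)
seq    (x *ℝ y) n = seq x n ℚ.* seq y n
cauchy (x *ℝ y)   = *-cauchy {seq x} {seq y} (cauchy x) (cauchy y)

-ℝ_ : ℝ → ℝ
seq    (-ℝ x) n = ℚ.- seq x n
cauchy (-ℝ x)   = neg-cauchy {seq x} (cauchy x)

private
  abstract
    pointwise : ∀ {x y} → (∀ n → seq x n ≡ seq y n) → x ≈ℝ y
    pointwise {x} eq .close ε 0<ε = 0 , λ n _ →
      subst (λ q → ∣ seq x n ℚ.- q ∣ ℚ.< ε) (eq n) (∣p-p∣<ε (seq x n) 0<ε)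

    ≈ℝ-sym : ∀ {x y} → x ≈ℝ y → y ≈ℝ x
    ≈ℝ-sym {x} {y} x≈y .close ε 0<ε with N , h ← close x≈y ε 0<ε = N , λ n p →
      subst (ℚ._< ε) (∣p-q∣≡∣q-p∣ (seq x n) (seq y n)) (h n p)

    ≈ℝ-trans : ∀ {x y z} → x ≈ℝ y → y ≈ℝ z → x ≈ℝ z
    ≈ℝ-trans {x} {y} {z} x≈y y≈z .close ε 0<ε
      with N , h ← close x≈y _ (0<½* 0<ε) | M , k ← close y≈z _ (0<½* 0<ε)
      = N ℕ.⊔ M , λ n p → trans-close {seq x n} {seq y n} {seq z n}
          (h n (ℕ.m⊔n≤o⇒m≤o N M p)) (k n (ℕ.m⊔n≤o⇒n≤o N M p))

    +ℝ-cong : ∀ {x x′ y y′} → x ≈ℝ x′ → y ≈ℝ y′ → x +ℝ y ≈ℝ x′ +ℝ y′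
    +ℝ-cong {x} {x′} {y} {y′} p q .close ε 0<ε
      with N , h ← close p _ (0<½* 0<ε) | M , k ← close q _ (0<½* 0<ε)
      = N ℕ.⊔ M , λ n r → +-close {seq x n} {seq x′ n} {seq y n} {seq y′ n}
          (h n (ℕ.m⊔n≤o⇒m≤o N M r)) (k n (ℕ.m⊔n≤o⇒n≤o N M r))

    -ℝ-cong : ∀ {x y} → x ≈ℝ y → -ℝ x ≈ℝ -ℝ y
    -ℝ-cong {x} {y} p .close ε 0<ε with N , h ← close (≈ℝ-sym p) ε 0<ε = N , λ n r →
      subst (ℚ._< ε)
        (cong ∣_∣ (neg-difference (seq x n) (seq y n)))
        (h n r)

    *ℝ-cong : ∀ {x x′ y y′} → x ≈ℝ x′ → y ≈ℝ y′ → x *ℝ y ≈ℝ x′ *ℝ y′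
    *ℝ-cong {x} {x′} {y} {y′} p q .close ε 0<ε
      with B , 0<B , L , b ← bounded₂ (cauchy⇒bounded (cauchy x)) (cauchy⇒bounded (cauchy y′))
      with δ , 0<δ , eq ← tolerance B ε 0<B 0<ε
      with N , h ← close p δ 0<δ | M , k ← close q δ 0<δ
      = L ℕ.⊔ (N ℕ.⊔ M) , λ n r →
        let bn = b n (ℕ.m⊔n≤o⇒m≤o L (N ℕ.⊔ M) r)
            r′ = ℕ.m⊔n≤o⇒n≤o L (N ℕ.⊔ M) r
        in *-close {seq x n} {seq x′ n} {seq y n} {seq y′ n} 0<B eq
             (proj₁ bn) (proj₂ bn)
             (h n (ℕ.m⊔n≤o⇒m≤o N M r′)) (k n (ℕ.m⊔n≤o⇒n≤o N M r′))

ℝ-commutativeRing : CommutativeRing 0ℓ 0ℓ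
ℝ-commutativeRing = record
  { Carrier = ℝ
  ; _≈_ = _≈ℝ_
  ; _+_ = _+ℝ_
  ; _*_ = _*ℝ_
  ; -_ = -ℝ_
  ; 0# = 0ℝ
  ; 1# = 1ℝ
  ; isCommutativeRing = record
    { isRing = record
      { +-isAbelianGroup = record
        { isGroup = record
          { isMonoid = record
            { isSemigroup = record
              { isMagma = record
                { isEquivalence = record
                  { refl = pointwise λ _ → refl
                  ; sym = ≈ℝ-sym
                  ; trans = ≈ℝ-trans
                  }
                ; ∙-cong = +ℝ-cong
                }
              ; assoc = λ x y z → pointwise λ n → ℚ.+-assoc (seq x n) (seq y n) (seq z n)
              }
            ; identity = (λ x → pointwise λ n → ℚ.+-identityˡ (seq x n))
                       , (λ x → pointwise λ n → ℚ.+-identityʳ (seq x n))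
            }
          ; inverse = (λ x → pointwise λ n → ℚ.+-inverseˡ (seq x n))
                    , (λ x → pointwise λ n → ℚ.+-inverseʳ (seq x n))
          ; ⁻¹-cong = -ℝ-cong
          }
        ; comm = λ x y → pointwise λ n → ℚ.+-comm (seq x n) (seq y n)
        }
      ; *-cong = *ℝ-cong
      ; *-assoc = λ x y z → pointwise λ n → ℚ.*-assoc (seq x n) (seq y n) (seq z n)
      ; *-identity = (λ x → pointwise λ n → ℚ.*-identityˡ (seq x n))
                   , (λ x → pointwise λ n → ℚ.*-identityʳ (seq x n))
      ; distrib = (λ x y z → pointwise λ n → ℚ.*-distribˡ-+ (seq x n) (seq y n) (seq z n))
                , (λ x y z → pointwise λ n → ℚ.*-distribʳ-+ (seq x n) (seq y n) (seq z n))
      }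
    ; *-comm = λ x y → pointwise λ n → ℚ.*-comm (seq x n) (seq y n)
    }
  }

record ℂ : Set where
  no-eta-equality
  field
    re : ℝ
    im : ℝ

open ℂ public

infix 4 _≈ℂ_

record _≈ℂ_ (z w : ℂ) : Set where
  constructor mk≈ℂ
  field
    re≈ : re z ≈ℝ re w
    im≈ : im z ≈ℝ im w

open _≈ℂ_ public

infixl 6 _+ℂ_
infixl 7 _*ℂ_
infix  8 -ℂ_

_+ℂ_ _*ℂ_ : ℂ → ℂ → ℂ
re (z +ℂ w) = re z +ℝ re w
im (z +ℂ w) = im z +ℝ im w
re (z *ℂ w) = re z *ℝ re w +ℝ -ℝ (im z *ℝ im w)
im (z *ℂ w) = re z *ℝ im w +ℝ im z *ℝ re w

-ℂ_ conj : ℂ → ℂ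
re (-ℂ z)   = -ℝ re z
im (-ℂ z)   = -ℝ im z
re (conj z) = re z
im (conj z) = -ℝ im z

ofℝ : ℝ → ℂ
re (ofℝ r) = r
im (ofℝ r) = 0ℝ

private
  module ComplexLaws {c ℓ} (R : CommutativeRing c ℓ) where
    open CommutativeRing R renaming (refl to ≈-refl; sym to ≈-sym)
    open RingProperties ring using (-‿+-comm; x[y-z]≈xy-xz; [y-z]x≈yx-zx; -0#≈0#)
    open SemigroupProperties +-commutativeSemigroup using (interchange)
    open Differences R using () renaming (sum-difference to sum-diff)
    open import Relation.Binary.Reasoning.Setoid setoid

    regroup-re : ∀ p q r s → (p - q) - (r + s) ≈ (p - r) - (s + q)
    regroup-re p q r s = begin
      (p - q) - (r + s)        ≈⟨ +-congˡ (-‿+-comm r s) ⟨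
      (p - q) + (- r + - s)    ≈⟨ interchange p (- q) (- r) (- s) ⟩
      (p - r) + (- q + - s)    ≈⟨ +-congˡ (+-comm (- q) (- s)) ⟩
      (p - r) + (- s + - q)    ≈⟨ +-congˡ (-‿+-comm s q) ⟩
      (p - r) - (s + q)        ∎

    regroup-im : ∀ p q r s → (p - q) + (r + s) ≈ (p + r) + (s - q)
    regroup-im p q r s = begin
      (p - q) + (r + s)    ≈⟨ interchange p (- q) r s ⟩
      (p + r) + (- q + s)  ≈⟨ +-congˡ (+-comm (- q) s) ⟩
      (p + r) + (s - q)    ∎

    *-assoc-re : ∀ a b c d e f →
      (a * c - b * d) * e - (a * d + b * c) * f ≈ a * (c * e - d * f) - b * (c * f + d * e)
    *-assoc-re a b c d e f = begin
      (a * c - b * d) * e - (a * d + b * c) * f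
        ≈⟨ +-cong ([y-z]x≈yx-zx e (a * c) (b * d)) (-‿cong (distribʳ f (a * d) (b * c))) ⟩
      (a * c * e - b * d * e) - (a * d * f + b * c * f)
        ≈⟨ regroup-re (a * c * e) (b * d * e) (a * d * f) (b * c * f) ⟩
      (a * c * e - a * d * f) - (b * c * f + b * d * e)
        ≈⟨ +-cong (+-cong (*-assoc a c e) (-‿cong (*-assoc a d f)))
                  (-‿cong (+-cong (*-assoc b c f) (*-assoc b d e))) ⟩
      (a * (c * e) - a * (d * f)) - (b * (c * f) + b * (d * e))
        ≈⟨ +-cong (x[y-z]≈xy-xz a (c * e) (d * f)) (-‿cong (distribˡ b (c * f) (d * e))) ⟨
      a * (c * e - d * f) - b * (c * f + d * e)  ∎

    *-assoc-im : ∀ a b c d e f →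
      (a * c - b * d) * f + (a * d + b * c) * e ≈ a * (c * f + d * e) + b * (c * e - d * f)
    *-assoc-im a b c d e f = begin
      (a * c - b * d) * f + (a * d + b * c) * e
        ≈⟨ +-cong ([y-z]x≈yx-zx f (a * c) (b * d)) (distribʳ e (a * d) (b * c)) ⟩
      (a * c * f - b * d * f) + (a * d * e + b * c * e)
        ≈⟨ regroup-im (a * c * f) (b * d * f) (a * d * e) (b * c * e) ⟩
      (a * c * f + a * d * e) + (b * c * e - b * d * f)
        ≈⟨ +-cong (+-cong (*-assoc a c f) (*-assoc a d e))
                  (+-cong (*-assoc b c e) (-‿cong (*-assoc b d f))) ⟩
      (a * (c * f) + a * (d * e)) + (b * (c * e) - b * (d * f))
        ≈⟨ +-cong (distribˡ a (c * f) (d * e)) (x[y-z]≈xy-xz b (c * e) (d * f)) ⟨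
      a * (c * f + d * e) + b * (c * e - d * f)  ∎

    distribˡ-re : ∀ a b c d e f →
      a * (c + e) - b * (d + f) ≈ (a * c - b * d) + (a * e - b * f)
    distribˡ-re a b c d e f = begin
      a * (c + e) - b * (d + f)              ≈⟨ +-cong (distribˡ a c e) (-‿cong (distribˡ b d f)) ⟩
      (a * c + a * e) - (b * d + b * f)      ≈⟨ sum-diff (a * c) (b * d) (a * e) (b * f) ⟨
      (a * c - b * d) + (a * e - b * f)      ∎

    distribˡ-im : ∀ a b c d e f →
      a * (d + f) + b * (c + e) ≈ (a * d + b * c) + (a * f + b * e)
    distribˡ-im a b c d e f = begin
      a * (d + f) + b * (c + e)              ≈⟨ +-cong (distribˡ a d f) (distribˡ b c e) ⟩
      (a * d + a * f) + (b * c + b * e)      ≈⟨ interchange (a * d) (a * f) (b * c) (b * e) ⟩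
      (a * d + b * c) + (a * f + b * e)      ∎

    *-comm-re : ∀ a b c d → a * c - b * d ≈ c * a - d * b
    *-comm-re a b c d = +-cong (*-comm a c) (-‿cong (*-comm b d))

    *-comm-im : ∀ a b c d → a * d + b * c ≈ c * b + d * a
    *-comm-im a b c d = begin
      a * d + b * c  ≈⟨ +-comm (a * d) (b * c) ⟩
      b * c + a * d  ≈⟨ +-cong (*-comm b c) (*-comm a d) ⟩
      c * b + d * a  ∎

    *-identityˡ-re : ∀ c d → 1# * c - 0# * d ≈ c
    *-identityˡ-re c d = begin
      1# * c - 0# * d  ≈⟨ +-cong (*-identityˡ c) (-‿cong (zeroˡ d)) ⟩
      c - 0#           ≈⟨ +-congˡ -0#≈0# ⟩
      c + 0#           ≈⟨ +-identityʳ c ⟩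
      c                ∎

    *-identityˡ-im : ∀ c d → 1# * d + 0# * c ≈ d
    *-identityˡ-im c d = begin
      1# * d + 0# * c  ≈⟨ +-cong (*-identityˡ d) (zeroˡ c) ⟩
      d + 0#           ≈⟨ +-identityʳ d ⟩
      d                ∎

  open ComplexLaws ℝ-commutativeRing
  module R = CommutativeRing ℝ-commutativeRing

  abstract
    ≈ℂ-sym : ∀ {z w} → z ≈ℂ w → w ≈ℂ z
    ≈ℂ-sym (mk≈ℂ p q) = mk≈ℂ (R.sym p) (R.sym q)

    ≈ℂ-trans : ∀ {z w v} → z ≈ℂ w → w ≈ℂ v → z ≈ℂ v
    ≈ℂ-trans (mk≈ℂ p q) (mk≈ℂ p′ q′) = mk≈ℂ (R.trans p p′) (R.trans q q′)

    +ℂ-cong : ∀ {z z′ w w′} → z ≈ℂ z′ → w ≈ℂ w′ → z +ℂ w ≈ℂ z′ +ℂ w′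
    +ℂ-cong (mk≈ℂ p q) (mk≈ℂ p′ q′) = mk≈ℂ (R.+-cong p p′) (R.+-cong q q′)

    *ℂ-cong : ∀ {z z′ w w′} → z ≈ℂ z′ → w ≈ℂ w′ → z *ℂ w ≈ℂ z′ *ℂ w′
    *ℂ-cong (mk≈ℂ p q) (mk≈ℂ p′ q′) = mk≈ℂ
      (R.+-cong (R.*-cong p p′) (R.-‿cong (R.*-cong q q′)))
      (R.+-cong (R.*-cong p q′) (R.*-cong q p′))

    *ℂ-comm : ∀ z w → z *ℂ w ≈ℂ w *ℂ z
    *ℂ-comm z w = mk≈ℂ
      (*-comm-re (re z) (im z) (re w) (im w))
      (*-comm-im (re z) (im z) (re w) (im w))

    *ℂ-identityˡ : ∀ z → ofℝ 1ℝ *ℂ z ≈ℂ z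
    *ℂ-identityˡ z = mk≈ℂ (*-identityˡ-re (re z) (im z)) (*-identityˡ-im (re z) (im z))

    *ℂ-assoc : ∀ z w v → (z *ℂ w) *ℂ v ≈ℂ z *ℂ (w *ℂ v)
    *ℂ-assoc z w v = mk≈ℂ
      (*-assoc-re (re z) (im z) (re w) (im w) (re v) (im v))
      (*-assoc-im (re z) (im z) (re w) (im w) (re v) (im v))

    *ℂ-distribˡ : ∀ z w v → z *ℂ (w +ℂ v) ≈ℂ z *ℂ w +ℂ z *ℂ v
    *ℂ-distribˡ z w v = mk≈ℂ
      (distribˡ-re (re z) (im z) (re w) (im w) (re v) (im v))
      (distribˡ-im (re z) (im z) (re w) (im w) (re v) (im v))

ℂ-commutativeRing : CommutativeRing 0ℓ 0ℓ
ℂ-commutativeRing = record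
  { Carrier = ℂ
  ; _≈_ = _≈ℂ_
  ; _+_ = _+ℂ_
  ; _*_ = _*ℂ_
  ; -_ = -ℂ_
  ; 0# = ofℝ 0ℝ
  ; 1# = ofℝ 1ℝ
  ; isCommutativeRing = record
    { isRing = record
      { +-isAbelianGroup = record
        { isGroup = record
          { isMonoid = record
            { isSemigroup = record
              { isMagma = record
                { isEquivalence = record
                  { refl = mk≈ℂ R.refl R.refl
                  ; sym = ≈ℂ-sym
                  ; trans = ≈ℂ-trans
                  }
                ; ∙-cong = +ℂ-cong
                }
              ; assoc = λ z w v → mk≈ℂ (R.+-assoc (re z) (re w) (re v))
                                         (R.+-assoc (im z) (im w) (im v))
              }
            ; identity = (λ z → mk≈ℂ (R.+-identityˡ (re z)) (R.+-identityˡ (im z)))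
                       , (λ z → mk≈ℂ (R.+-identityʳ (re z)) (R.+-identityʳ (im z)))
            }
          ; inverse = (λ z → mk≈ℂ (R.-‿inverseˡ (re z)) (R.-‿inverseˡ (im z)))
                    , (λ z → mk≈ℂ (R.-‿inverseʳ (re z)) (R.-‿inverseʳ (im z)))
          ; ⁻¹-cong = λ (mk≈ℂ p q) → mk≈ℂ (R.-‿cong p) (R.-‿cong q)
          }
        ; comm = λ z w → mk≈ℂ (R.+-comm (re z) (re w)) (R.+-comm (im z) (im w))
        }
      ; *-cong = *ℂ-cong
      ; *-assoc = *ℂ-assoc
      ; *-identity = *ℂ-identityˡ
                   , (λ z → ≈ℂ-trans (*ℂ-comm z (ofℝ 1ℝ)) (*ℂ-identityˡ z))
      ; distrib = *ℂ-distribˡ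
                , (λ z w v → ≈ℂ-trans (*ℂ-comm (w +ℂ v) z)
                    (≈ℂ-trans (*ℂ-distribˡ z w v) (+ℂ-cong (*ℂ-comm z w) (*ℂ-comm z v))))
      }
    ; *-comm = *ℂ-comm
    }
  }

open SemiringSum (CommutativeRing.semiring ℝ-commutativeRing) using () renaming (sum to ∑ℝ)
open SemiringSum (CommutativeRing.semiring ℂ-commutativeRing) using () renaming (sum to ∑ℂ)

Matrix : Set → ℕ → Set
Matrix A l = Vector (Vector A l) l

transpose : ∀ {A l} → Matrix A l → Matrix A l
transpose A i j = A j i

infix 4 _≈ᴹ_
infixl 6 _-ᴹ_
infixl 7 _*ᴹ_

_≈ᴹ_ : ∀ {l} → Matrix ℝ l → Matrix ℝ l → Set
A ≈ᴹ B = ∀ i j → A i j ≈ℝ B i j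

Oᴹ Iᴹ : ∀ {l} → Matrix ℝ l
Oᴹ i j = 0ℝ
Iᴹ i j = if does (i Fin.≟ j) then 1ℝ else 0ℝ

_-ᴹ_ _*ᴹ_ : ∀ {l} → Matrix ℝ l → Matrix ℝ l → Matrix ℝ l
(A -ᴹ B) i j = A i j +ℝ -ℝ B i j
(A *ᴹ B) i j = ∑ℝ λ k → A i k *ℝ B k j

IsInvertible : ∀ {l} → Matrix ℝ l → Set
IsInvertible A = ∃ λ B → A *ᴹ B ≈ᴹ Iᴹ × B *ᴹ A ≈ᴹ Iᴹ

infix  4 _≈ⱽ_
infixr 7 _·_ _•_

_≈ⱽ_ : ∀ {l} → Vector ℂ l → Vector ℂ l → Set
x ≈ⱽ y = ∀ i → x i ≈ℂ y i

0ⱽ : ∀ {l} → Vector ℂ l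
0ⱽ i = ofℝ 0ℝ

_•_ : ∀ {l} → ℂ → Vector ℂ l → Vector ℂ l
(z • x) i = z *ℂ x i

_·_ : ∀ {l} → Matrix ℝ l → Vector ℂ l → Vector ℂ l
(A · x) i = ∑ℂ λ j → ofℝ (A i j) *ℂ x j

⟨_,_⟩ : ∀ {l} → Vector ℂ l → Vector ℂ l → ℂ
⟨ x , y ⟩ = ∑ℂ λ i → x i *ℂ conj (y i)

-- ‖ x ‖≡ r says that r is the nonnegative square root of ⟨ x , x ⟩.
‖_‖≡_ : ∀ {l} → Vector ℂ l → ℝ → Set
‖ x ‖≡ r = 0ℝ ≤ℝ r × ofℝ (r *ℝ r) ≈ℂ ⟨ x , x ⟩

IsEigenvector : ∀ {l} → Matrix ℝ l → Vector ℂ l → Set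
IsEigenvector A x = ¬ (x ≈ⱽ 0ⱽ) × ∃ λ z → A · x ≈ⱽ z • x

-- An array of period p consists of the entries with i - 2 ≤ j ≤ i + p - 2 (see InStrip);
-- for p ≥ 1, the values of the function at other indices are junk that no condition below uses.
Array : Set → Set
Array A = ℤ → ℤ → A

module _ (p : ℕ) where

  InStrip : ℤ → ℤ → Set
  InStrip i j = i ℤ.- + 2 ℤ.≤ j × j ℤ.≤ i ℤ.+ + p ℤ.- + 2

  NonTrivial : ℤ → ℤ → Set
  NonTrivial i j = i ℤ.≤ j × j ℤ.≤ i ℤ.+ + p ℤ.- + 4

  RuleRange : ℤ → ℤ → Set
  RuleRange i j = i ℤ.- + 1 ℤ.≤ j × j ℤ.≤ i ℤ.+ + p ℤ.- + 3

  nonTrivial? : ∀ i j → Dec (NonTrivial i j)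
  nonTrivial? i j = i ℤ.≤? j ×-dec j ℤ.≤? i ℤ.+ + p ℤ.- + 4

  record IsMatrixArray {l} (M : Array (Matrix ℝ l)) : Set where
    field
      periodic    : ∀ i j → InStrip i j → M (i ℤ.+ + p) (j ℤ.+ + p) ≈ᴹ M i j
      first-O     : ∀ i → M i (i ℤ.- + 2) ≈ᴹ Oᴹ
      last-O      : ∀ i → M i (i ℤ.+ + p ℤ.- + 2) ≈ᴹ Oᴹ
      first-I     : ∀ i → M i (i ℤ.- + 1) ≈ᴹ Iᴹ
      last-I      : ∀ i → M i (i ℤ.+ + p ℤ.- + 3) ≈ᴹ Iᴹ
      invertible  : ∀ i j → NonTrivial i j → IsInvertible (M i j)

  LeftRule RightRule : ∀ {l} → Array (Matrix ℝ l) → Set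
  LeftRule M = ∀ i j → RuleRange i j →
    M i j *ᴹ M (ℤ.suc i) (ℤ.suc j) -ᴹ M i (ℤ.suc j) *ᴹ M (ℤ.suc i) j ≈ᴹ Iᴹ
  RightRule M = ∀ i j → RuleRange i j →
    M (ℤ.suc i) (ℤ.suc j) *ᴹ M i j -ᴹ M (ℤ.suc i) j *ᴹ M i (ℤ.suc j) ≈ᴹ Iᴹ

  IsLeftFrieze IsRightFrieze IsTwoSidedFrieze IsMatrixFrieze :
    ∀ {l} → Array (Matrix ℝ l) → Set
  IsLeftFrieze     M = IsMatrixArray M × LeftRule M
  IsRightFrieze    M = IsMatrixArray M × RightRule M
  IsTwoSidedFrieze M = IsLeftFrieze M × IsRightFrieze M
  IsMatrixFrieze   M = IsLeftFrieze M ⊎ IsRightFrieze M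

  record IsScalarFrieze (m : Array ℂ) : Set where
    field
      periodic   : ∀ i j → InStrip i j → m (i ℤ.+ + p) (j ℤ.+ + p) ≈ℂ m i j
      first-0    : ∀ i → m i (i ℤ.- + 2) ≈ℂ ofℝ 0ℝ
      last-0     : ∀ i → m i (i ℤ.+ + p ℤ.- + 2) ≈ℂ ofℝ 0ℝ
      first-1    : ∀ i → m i (i ℤ.- + 1) ≈ℂ ofℝ 1ℝ
      last-1     : ∀ i → m i (i ℤ.+ + p ℤ.- + 3) ≈ℂ ofℝ 1ℝ
      unimodular : ∀ i j → RuleRange i j →
        m i j *ℂ m (ℤ.suc i) (ℤ.suc j) +ℂ -ℂ (m i (ℤ.suc j) *ℂ m (ℤ.suc i) j) ≈ℂ ofℝ 1ℝ

  transposeNonTrivial : ∀ {l} → Array (Matrix ℝ l) → Array (Matrix ℝ l)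
  transposeNonTrivial M i j = if does (nonTrivial? i j) then transpose (M i j) else M i j

  EntriesCommute : ∀ {l} → Array (Matrix ℝ l) → Set
  EntriesCommute M = ∀ i j i′ j′ → InStrip i j → InStrip i′ j′ →
    M i j *ᴹ M i′ j′ ≈ᴹ M i′ j′ *ᴹ M i j

  IsCommonEigenvector : ∀ {l} → Array (Matrix ℝ l) → Vector ℂ l → Set
  IsCommonEigenvector M x = ∀ i j → InStrip i j → IsEigenvector (M i j) x

scalarArray : ∀ {l} → Array (Matrix ℝ l) → Vector ℂ l → Array ℂ
scalarArray M x i j = ⟨ M i j · x , x ⟩

{-# OPTIONS --safe #-}
module Submission where

-- Transposition reverses products, so it interchanges the left and the right rule; the boundary
-- rows consist of symmetric matrices, so there transposing is the same as not transposing.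
-- On a unit eigenvector x the scalar ⟨ A · x , x ⟩ is the eigenvalue of A, and eigenvalues at a
-- common eigenvector are multiplicative and additive in A.

open import Defs
open import Algebra.Bundles using (CommutativeRing; Ring)
import Algebra.Properties.Ring as RingProperties
import Algebra.Properties.Semiring.Sum as SemiringSum
open import Data.Bool.Base using (if_then_else_)
open import Data.Fin.Base using (zero; suc)
open import Data.Integer.Base as ℤ using (ℤ; +_)
import Data.Integer.Properties as ℤ
open import Data.Integer.Tactic.RingSolver using (solve-∀)
open import Data.Nat.Base as ℕ using (ℕ)
open import Data.Product using (_×_; _,_; proj₁; proj₂)
open import Data.Sum using (_⊎_; inj₁; inj₂; [_,_]′)
open import Data.Vec.Functional using (Vector; tail)
open import Function.Base using (_∘_)
open import Relation.Binary.PropositionalEquality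
  using (_≡_; refl; sym; subst)
import Relation.Binary.Reasoning.Setoid as SetoidReasoning
open import Relation.Nullary using (¬_; Dec; does; yes; no; contradiction)

private
  module R = CommutativeRing ℝ-commutativeRing
  module C = CommutativeRing ℂ-commutativeRing
  module ∑R = SemiringSum R.semiring
  module ∑C = SemiringSum C.semiring

-- The entries of `transposeNonTrivial` are conditionals on `does`. Passing the motive `Q`
-- explicitly lets any property of such an entry be proved by cases on the decision.
if-does : ∀ {a p q} {A : Set a} {P : Set p} (Q : A → Set q) {x y : A} (P? : Dec P) →
          (P → Q x) → (¬ P → Q y) → Q (if does P? then x else y)
if-does Q (yes p) f g = f p
if-does Q (no ¬p) f g = g ¬p

-- Index arithmetic

-- This lemma and the next split one row off a range of indices, from below and from above;
-- `strip-cases` applies each of them twice.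
≤⇒≡⊎suc≤ : ∀ {i j} → i ℤ.≤ j → j ≡ i ⊎ ℤ.suc i ℤ.≤ j
≤⇒≡⊎suc≤ {i} {j} i≤j with j ℤ.≟ i
... | yes j≡i = inj₁ j≡i
... | no  j≢i = inj₂ (ℤ.i<j⇒suc[i]≤j (ℤ.≤∧≢⇒< i≤j (j≢i ∘ sym)))

≤⇒≡⊎≤pred : ∀ {i j} → i ℤ.≤ j → i ≡ j ⊎ i ℤ.≤ ℤ.pred j
≤⇒≡⊎≤pred {i} {j} i≤j with i ℤ.≟ j
... | yes i≡j = inj₁ i≡j
... | no  i≢j = inj₂ (ℤ.i<j⇒i≤pred[j] (ℤ.≤∧≢⇒< i≤j i≢j))

-- `ℤ.suc` and `ℤ.pred` are unfolded to additions of `+ 1` and `ℤ.- + 1`, so that both sides are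
-- ring expressions; the unfolded forms are definitionally equal to the ones met below.
suc[i-2] : ∀ i → + 1 ℤ.+ (i ℤ.- + 2) ≡ i ℤ.- + 1
suc[i-2] = solve-∀

suc[i-1] : ∀ i → + 1 ℤ.+ (i ℤ.- + 1) ≡ i
suc[i-1] = solve-∀

pred[k-2] : ∀ k → ℤ.- + 1 ℤ.+ (k ℤ.- + 2) ≡ k ℤ.- + 3
pred[k-2] = solve-∀

pred[k-3] : ∀ k → ℤ.- + 1 ℤ.+ (k ℤ.- + 3) ≡ k ℤ.- + 4
pred[k-3] = solve-∀

suc[i]-2 : ∀ i → i ℤ.- + 1 ≡ + 1 ℤ.+ i ℤ.- + 2
suc[i]-2 = solve-∀

suc[k-3] : ∀ k → + 1 ℤ.+ (k ℤ.- + 3) ≡ k ℤ.- + 2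
suc[k-3] = solve-∀

suc-shift : ∀ i q n → + 1 ℤ.+ (i ℤ.+ q ℤ.- n) ≡ + 1 ℤ.+ i ℤ.+ q ℤ.- n
suc-shift = solve-∀

add-shift : ∀ i q n → i ℤ.- n ℤ.+ q ≡ i ℤ.+ q ℤ.- n
add-shift = solve-∀

add-shift₂ : ∀ i q n → i ℤ.+ q ℤ.- n ℤ.+ q ≡ i ℤ.+ q ℤ.+ q ℤ.- n
add-shift₂ = solve-∀

-- The strip and its boundary rows

module _ (p : ℕ) where

  -- The column is an index of the family, so matching on a constructor fixes it and exposes the
  -- field of `IsMatrixArray` for that row. For small `p` some of these rows coincide.
  data Boundary (i : ℤ) : ℤ → Set where
    first-zero : Boundary i (i ℤ.- + 2)
    first-one  : Boundary i (i ℤ.- + 1)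
    last-one   : Boundary i (i ℤ.+ + p ℤ.- + 3)
    last-zero  : Boundary i (i ℤ.+ + p ℤ.- + 2)

  -- Two rows are removed at the lower end and two at the upper end; the bounds that remain are
  -- those of `NonTrivial`.
  strip-cases : ∀ i j → InStrip p i j → NonTrivial p i j ⊎ Boundary i j
  strip-cases i j (lower , upper) with ≤⇒≡⊎suc≤ lower
  ... | inj₁ refl = inj₂ first-zero
  ... | inj₂ i-1≤j with ≤⇒≡⊎suc≤ (subst (ℤ._≤ j) (suc[i-2] i) i-1≤j)
  ...   | inj₁ refl = inj₂ first-one
  ...   | inj₂ i≤j with ≤⇒≡⊎≤pred upper
  ...     | inj₁ refl = inj₂ last-zero
  ...     | inj₂ j≤ with ≤⇒≡⊎≤pred (subst (j ℤ.≤_) (pred[k-2] (i ℤ.+ + p)) j≤)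
  ...       | inj₁ refl = inj₂ last-one
  ...       | inj₂ j≤′ = inj₁
    (subst (ℤ._≤ j) (suc[i-1] i) i≤j , subst (j ℤ.≤_) (pred[k-3] (i ℤ.+ + p)) j≤′)

  -- Periodicity of the transposed array compares two entries, and the translated one must also be
  -- known to lie in the strip.
  strip-translate : ∀ i j → InStrip p i j → InStrip p (i ℤ.+ + p) (j ℤ.+ + p)
  strip-translate i j (lower , upper) =
    subst (ℤ._≤ j ℤ.+ + p) (add-shift i (+ p) (+ 2)) (ℤ.+-monoˡ-≤ (+ p) lower) ,
    subst (j ℤ.+ + p ℤ.≤_) (add-shift₂ i (+ p) (+ 2)) (ℤ.+-monoˡ-≤ (+ p) upper)

  module _ (i j : ℤ) (r : RuleRange p i j) where
    private
      suc-j-upper : ℤ.suc j ℤ.≤ i ℤ.+ + p ℤ.- + 2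
      suc-j-upper = subst (ℤ.suc j ℤ.≤_) (suc[k-3] (i ℤ.+ + p)) (ℤ.suc-mono (proj₂ r))

      suc-i-lower : ℤ.suc i ℤ.- + 2 ℤ.≤ j
      suc-i-lower = subst (ℤ._≤ j) (suc[i]-2 i) (proj₁ r)

      lower : i ℤ.- + 2 ℤ.≤ j
      lower = ℤ.≤-trans (ℤ.i≤suc[i] (i ℤ.- + 2)) (subst (ℤ._≤ j) (sym (suc[i-2] i)) (proj₁ r))

      upper-suc : i ℤ.+ + p ℤ.- + 2 ℤ.≤ ℤ.suc i ℤ.+ + p ℤ.- + 2
      upper-suc = subst (i ℤ.+ + p ℤ.- + 2 ℤ.≤_) (suc-shift i (+ p) (+ 2)) (ℤ.i≤suc[i] _)

    -- The names place the four entries of a rule as corners of a square, with `i` counting rows and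
    -- `j` columns. `RuleRange` is tight at two corners: its lower bound is that of the strip at SW,
    -- its upper bound that of the strip at NE.
    rule-NW : InStrip p i j
    rule-NW = lower , ℤ.≤-trans (ℤ.i≤suc[i] j) suc-j-upper

    rule-NE : InStrip p i (ℤ.suc j)
    rule-NE = ℤ.i≤j⇒i≤1+j lower , suc-j-upper

    rule-SW : InStrip p (ℤ.suc i) j
    rule-SW = suc-i-lower , ℤ.≤-trans (proj₂ rule-NW) upper-suc

    rule-SE : InStrip p (ℤ.suc i) (ℤ.suc j)
    rule-SE = ℤ.i≤j⇒i≤1+j suc-i-lower , ℤ.≤-trans suc-j-upper upper-suc

-- Matrices and transposition

module _ {l : ℕ} where

  ≈ᴹ-sym : {A B : Matrix ℝ l} → A ≈ᴹ B → B ≈ᴹ A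
  ≈ᴹ-sym A≈B i j = R.sym (A≈B i j)

  ≈ᴹ-trans : {A B D : Matrix ℝ l} → A ≈ᴹ B → B ≈ᴹ D → A ≈ᴹ D
  ≈ᴹ-trans A≈B B≈D i j = R.trans (A≈B i j) (B≈D i j)

  *ᴹ-cong : {A A′ B B′ : Matrix ℝ l} → A ≈ᴹ A′ → B ≈ᴹ B′ → A *ᴹ B ≈ᴹ A′ *ᴹ B′
  *ᴹ-cong A≈ B≈ i j = ∑R.sum-cong-≋ λ k → R.*-cong (A≈ i k) (B≈ k j)

  -ᴹ-cong : {A A′ B B′ : Matrix ℝ l} → A ≈ᴹ A′ → B ≈ᴹ B′ → A -ᴹ B ≈ᴹ A′ -ᴹ B′
  -ᴹ-cong A≈ B≈ i j = R.+-cong (A≈ i j) (R.-‿cong (B≈ i j))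

  transpose-* : (A B : Matrix ℝ l) → transpose (A *ᴹ B) ≈ᴹ transpose B *ᴹ transpose A
  transpose-* A B i j = ∑R.sum-cong-≋ λ k → R.*-comm (A j k) (B k i)

  transpose-cong : {A B : Matrix ℝ l} → A ≈ᴹ B → transpose A ≈ᴹ transpose B
  transpose-cong A≈B i j = A≈B j i

  IsSymmetric : Matrix ℝ l → Set
  IsSymmetric A = transpose A ≈ᴹ A

  Oᴹ-symmetric : IsSymmetric Oᴹ
  Oᴹ-symmetric i j = R.refl

-- Splitting both indices makes the conditional compute. For two successors the decision has the
-- same `does` as for their predecessors, so the recursive call has the required type.
Iᴹ-symmetric : ∀ {l} → IsSymmetric (Iᴹ {l})
Iᴹ-symmetric zero    zero    = R.refl
Iᴹ-symmetric zero    (suc j) = R.refl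
Iᴹ-symmetric (suc i) zero    = R.refl
Iᴹ-symmetric (suc i) (suc j) = Iᴹ-symmetric i j

module _ {l : ℕ} where

  symmetric-resp-≈ : {A B : Matrix ℝ l} → A ≈ᴹ B → IsSymmetric B → IsSymmetric A
  symmetric-resp-≈ A≈B sB = ≈ᴹ-trans (transpose-cong A≈B) (≈ᴹ-trans sB (≈ᴹ-sym A≈B))

  -- Reversal of products turns a left inverse into a right inverse and conversely, so the two
  -- identities for `B` exchange roles.
  transpose-invertible : {A : Matrix ℝ l} → IsInvertible A → IsInvertible (transpose A)
  transpose-invertible {A} (B , AB≈I , BA≈I) = transpose B ,
    ≈ᴹ-trans (≈ᴹ-sym (transpose-* B A)) (symmetric-inverse BA≈I) ,
    ≈ᴹ-trans (≈ᴹ-sym (transpose-* A B)) (symmetric-inverse AB≈I)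
    where
    symmetric-inverse : {D : Matrix ℝ l} → D ≈ᴹ Iᴹ → transpose D ≈ᴹ Iᴹ
    symmetric-inverse D≈I = ≈ᴹ-trans (transpose-cong D≈I) Iᴹ-symmetric

  -- The primed matrices are transposes only up to `≈ᴹ`, as boundary entries of the transposed array
  -- are left unchanged. Both products are reversed, so a suitable choice of corners carries either
  -- rule to the other.
  transpose-rule : {A B D E A′ B′ D′ E′ : Matrix ℝ l} →
    A′ ≈ᴹ transpose A → B′ ≈ᴹ transpose B → D′ ≈ᴹ transpose D → E′ ≈ᴹ transpose E →
    A *ᴹ B -ᴹ D *ᴹ E ≈ᴹ Iᴹ → B′ *ᴹ A′ -ᴹ E′ *ᴹ D′ ≈ᴹ Iᴹ
  transpose-rule {A} {B} {D} {E} a b d e rule =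
    ≈ᴹ-trans
      (-ᴹ-cong (≈ᴹ-trans (*ᴹ-cong b a) (≈ᴹ-sym (transpose-* A B)))
               (≈ᴹ-trans (*ᴹ-cong e d) (≈ᴹ-sym (transpose-* D E))))
      (≈ᴹ-trans (transpose-cong rule) Iᴹ-symmetric)

-- The transposed frieze

module TransposedFrieze {l : ℕ} (p : ℕ) {M : Array (Matrix ℝ l)} (isArray : IsMatrixArray p M) where
  open IsMatrixArray isArray

  Mᵗ : Array (Matrix ℝ l)
  Mᵗ = transposeNonTrivial p M

  boundary-symmetric : ∀ {i j} → Boundary p i j → IsSymmetric (M i j)
  boundary-symmetric {i} first-zero = symmetric-resp-≈ (first-O i) Oᴹ-symmetric
  boundary-symmetric {i} first-one  = symmetric-resp-≈ (first-I i) Iᴹ-symmetric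
  boundary-symmetric {i} last-one   = symmetric-resp-≈ (last-I i) Iᴹ-symmetric
  boundary-symmetric {i} last-zero  = symmetric-resp-≈ (last-O i) Oᴹ-symmetric

  -- This removes the case distinction: inside the strip the array may be treated as the entrywise
  -- transpose, because the entries left unchanged are symmetric.
  transposed : ∀ i j → InStrip p i j → Mᵗ i j ≈ᴹ transpose (M i j)
  transposed i j s = if-does (_≈ᴹ transpose (M i j)) (nonTrivial? p i j)
    (λ _ _ _ → R.refl)
    λ trivial → [ (λ nonTrivial → contradiction nonTrivial trivial)
                , (λ b → ≈ᴹ-sym (boundary-symmetric b)) ]′ (strip-cases p i j s)

  -- For p = 0 the inner boundary rows lie outside the strip, hence no appeal to transposed.
  transposed-boundary : ∀ {i j S} → IsSymmetric S → M i j ≈ᴹ S → Mᵗ i j ≈ᴹ S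
  transposed-boundary {i} {j} {S} sS M≈S = if-does (_≈ᴹ S) (nonTrivial? p i j)
    (λ _ → ≈ᴹ-trans (transpose-cong M≈S) sS)
    (λ _ → M≈S)

  isMatrixArray : IsMatrixArray p Mᵗ
  isMatrixArray = record
    { periodic   = λ i j s → ≈ᴹ-trans (transposed _ _ (strip-translate p i j s))
        (≈ᴹ-trans (transpose-cong (periodic i j s)) (≈ᴹ-sym (transposed i j s)))
    ; first-O    = λ i → transposed-boundary Oᴹ-symmetric (first-O i)
    ; last-O     = λ i → transposed-boundary Oᴹ-symmetric (last-O i)
    ; first-I    = λ i → transposed-boundary Iᴹ-symmetric (first-I i)
    ; last-I     = λ i → transposed-boundary Iᴹ-symmetric (last-I i)
    ; invertible = λ i j n → if-does IsInvertible (nonTrivial? p i j)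
        (λ _ → transpose-invertible (invertible i j n))
        (λ _ → invertible i j n)
    }

  left⇒right : LeftRule p M → RightRule p Mᵗ
  left⇒right rule i j r = transpose-rule
    (transposed i j (rule-NW p i j r)) (transposed (ℤ.suc i) (ℤ.suc j) (rule-SE p i j r))
    (transposed i (ℤ.suc j) (rule-NE p i j r)) (transposed (ℤ.suc i) j (rule-SW p i j r)) (rule i j r)

  right⇒left : RightRule p M → LeftRule p Mᵗ
  right⇒left rule i j r = transpose-rule
    (transposed (ℤ.suc i) (ℤ.suc j) (rule-SE p i j r)) (transposed i j (rule-NW p i j r))
    (transposed (ℤ.suc i) j (rule-SW p i j r)) (transposed i (ℤ.suc j) (rule-NE p i j r)) (rule i j r)

module _ {l : ℕ} (p : ℕ) {M : Array (Matrix ℝ l)} where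

  transpose-left : IsLeftFrieze p M → IsRightFrieze p (transposeNonTrivial p M)
  transpose-left (isArray , rule) = isMatrixArray , left⇒right rule
    where open TransposedFrieze p isArray

  transpose-right : IsRightFrieze p M → IsLeftFrieze p (transposeNonTrivial p M)
  transpose-right (isArray , rule) = isMatrixArray , right⇒left rule
    where open TransposedFrieze p isArray

-- Real matrices acting on complex vectors

module _ {c ℓ} (S : Ring c ℓ) where
  open Ring S hiding (zero) renaming (refl to ≈-refl; trans to ≈-trans; sym to ≈-sym)
  open RingProperties S using (-0#≈0#; -‿+-comm)
  open SemiringSum semiring using (sum; ∑-distrib-+)

  sum-neg : ∀ {n} (f : Vector Carrier n) → sum (λ i → - f i) ≈ - sum f
  sum-neg {ℕ.zero}  f = ≈-sym -0#≈0#
  sum-neg {ℕ.suc n} f = ≈-trans (+-congˡ (sum-neg (tail f))) (-‿+-comm (f zero) (sum (tail f)))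

  sum-sub : ∀ {n} (f g : Vector Carrier n) → sum (λ i → f i - g i) ≈ sum f - sum g
  sum-sub f g = ≈-trans (∑-distrib-+ f (λ i → - g i)) (+-congˡ (sum-neg g))

-- `ofℝ` is a ring homomorphism; this and the next lemmas carry identities of real matrix entries
-- over to the action on complex vectors.
ofℝ-cong : ∀ {a b} → a ≈ℝ b → ofℝ a ≈ℂ ofℝ b
ofℝ-cong a≈b = mk≈ℂ a≈b R.refl

ofℝ-+ : ∀ a b → ofℝ (a +ℝ b) ≈ℂ ofℝ a +ℂ ofℝ b
ofℝ-+ a b = mk≈ℂ R.refl (R.sym (R.+-identityˡ 0ℝ))

ofℝ-neg : ∀ a → ofℝ (-ℝ a) ≈ℂ -ℂ ofℝ a
ofℝ-neg a = mk≈ℂ R.refl (R.sym (RingProperties.-0#≈0# R.ring))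

ofℝ-* : ∀ a b → ofℝ (a *ℝ b) ≈ℂ ofℝ a *ℂ ofℝ b
ofℝ-* a b = mk≈ℂ
  (begin
    a *ℝ b                    ≈⟨ R.+-identityʳ (a *ℝ b) ⟨
    a *ℝ b +ℝ 0ℝ              ≈⟨ R.+-congˡ (RingProperties.-0#≈0# R.ring) ⟨
    a *ℝ b +ℝ -ℝ 0ℝ           ≈⟨ R.+-congˡ (R.-‿cong (R.zeroˡ 0ℝ)) ⟨
    a *ℝ b +ℝ -ℝ (0ℝ *ℝ 0ℝ)   ∎)
  (begin
    0ℝ                        ≈⟨ R.+-identityˡ 0ℝ ⟨
    0ℝ +ℝ 0ℝ                  ≈⟨ R.+-cong (R.zeroʳ a) (R.zeroˡ b) ⟨
    a *ℝ 0ℝ +ℝ 0ℝ *ℝ b        ∎)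
  where open SetoidReasoning R.setoid

ofℝ-∑ : ∀ {n} (f : Vector ℝ n) → ofℝ (∑R.sum f) ≈ℂ ∑C.sum (ofℝ ∘ f)
ofℝ-∑ {ℕ.zero}  f = C.refl
ofℝ-∑ {ℕ.suc n} f = C.trans (ofℝ-+ (f zero) _) (C.+-congˡ (ofℝ-∑ (tail f)))

module _ {l : ℕ} where
  open SetoidReasoning C.setoid

  ·-cong : {A B : Matrix ℝ l} {x y : Vector ℂ l} → A ≈ᴹ B → x ≈ⱽ y → A · x ≈ⱽ B · y
  ·-cong A≈B x≈y i = ∑C.sum-cong-≋ λ j → C.*-cong (ofℝ-cong (A≈B i j)) (x≈y j)

  ⟨,⟩-congˡ : {u v : Vector ℂ l} (y : Vector ℂ l) → u ≈ⱽ v → ⟨ u , y ⟩ ≈ℂ ⟨ v , y ⟩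
  ⟨,⟩-congˡ y u≈v = ∑C.sum-cong-≋ λ i → C.*-congʳ (u≈v i)

  ⟨•,⟩ : ∀ z (x y : Vector ℂ l) → ⟨ z • x , y ⟩ ≈ℂ z *ℂ ⟨ x , y ⟩
  ⟨•,⟩ z x y = begin
    ∑C.sum (λ i → z *ℂ x i *ℂ conj (y i))    ≈⟨ ∑C.sum-cong-≋ (λ i → C.*-assoc z (x i) (conj (y i))) ⟩
    ∑C.sum (λ i → z *ℂ (x i *ℂ conj (y i)))  ≈⟨ ∑C.*-distribˡ-sum z (λ i → x i *ℂ conj (y i)) ⟨
    z *ℂ ⟨ x , y ⟩                           ∎

  ·-• : (A : Matrix ℝ l) → ∀ z x → A · (z • x) ≈ⱽ z • (A · x)
  ·-• A z x i = begin
    ∑C.sum (λ j → ofℝ (A i j) *ℂ (z *ℂ x j))  ≈⟨ ∑C.sum-cong-≋ (λ j → x∙yz≈y∙xz (ofℝ (A i j)) z (x j)) ⟩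
    ∑C.sum (λ j → z *ℂ (ofℝ (A i j) *ℂ x j))  ≈⟨ ∑C.*-distribˡ-sum z (λ j → ofℝ (A i j) *ℂ x j) ⟨
    z *ℂ (A · x) i                            ∎
    where open import Algebra.Properties.CommutativeSemigroup C.*-commutativeSemigroup using (x∙yz≈y∙xz)

  -- The factor `x j` moves into the inner sum, the two finite sums are exchanged, and the entry of
  -- `A` is pulled out.
  *ᴹ-· : (A B : Matrix ℝ l) → ∀ x → (A *ᴹ B) · x ≈ⱽ A · (B · x)
  *ᴹ-· A B x i = begin
    ∑C.sum (λ j → ofℝ ((A *ᴹ B) i j) *ℂ x j)
      ≈⟨ ∑C.sum-cong-≋ (λ j → C.*-congʳ (C.trans (ofℝ-∑ λ k → A i k *ℝ B k j)
           (∑C.sum-cong-≋ λ k → ofℝ-* (A i k) (B k j)))) ⟩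
    ∑C.sum (λ j → ∑C.sum (λ k → a k *ℂ b k j) *ℂ x j)
      ≈⟨ ∑C.sum-cong-≋ (λ j → ∑C.*-distribʳ-sum (x j) (λ k → a k *ℂ b k j)) ⟩
    ∑C.sum (λ j → ∑C.sum (λ k → a k *ℂ b k j *ℂ x j))
      ≈⟨ ∑C.∑-comm (λ j k → a k *ℂ b k j *ℂ x j) ⟩
    ∑C.sum (λ k → ∑C.sum (λ j → a k *ℂ b k j *ℂ x j))
      ≈⟨ ∑C.sum-cong-≋ (λ k → ∑C.sum-cong-≋ λ j → C.*-assoc (a k) (b k j) (x j)) ⟩
    ∑C.sum (λ k → ∑C.sum (λ j → a k *ℂ (b k j *ℂ x j)))
      ≈⟨ ∑C.sum-cong-≋ (λ k → ∑C.*-distribˡ-sum (a k) (λ j → b k j *ℂ x j)) ⟨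
    ∑C.sum (λ k → a k *ℂ (B · x) k)  ∎
    where
    a = λ k → ofℝ (A i k)
    b = λ k j → ofℝ (B k j)

  -ᴹ-· : (A B : Matrix ℝ l) → ∀ x i → ((A -ᴹ B) · x) i ≈ℂ (A · x) i +ℂ -ℂ (B · x) i
  -ᴹ-· A B x i = begin
    ∑C.sum (λ j → ofℝ (A i j +ℝ -ℝ B i j) *ℂ x j)
      ≈⟨ ∑C.sum-cong-≋ (λ j → C.*-congʳ
           (C.trans (ofℝ-+ (A i j) (-ℝ B i j)) (C.+-congˡ (ofℝ-neg (B i j))))) ⟩
    ∑C.sum (λ j → (ofℝ (A i j) +ℂ -ℂ ofℝ (B i j)) *ℂ x j)
      ≈⟨ ∑C.sum-cong-≋ (λ j → [y-z]x≈yx-zx (x j) (ofℝ (A i j)) (ofℝ (B i j))) ⟩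
    ∑C.sum (λ j → ofℝ (A i j) *ℂ x j +ℂ -ℂ (ofℝ (B i j) *ℂ x j))
      ≈⟨ sum-sub C.ring (λ j → ofℝ (A i j) *ℂ x j) (λ j → ofℝ (B i j) *ℂ x j) ⟩
    (A · x) i +ℂ -ℂ (B · x) i  ∎
    where open RingProperties C.ring using ([y-z]x≈yx-zx)

∑-zeroˡ : ∀ {n} (x : Vector ℂ n) → ∑C.sum (λ j → ofℝ 0ℝ *ℂ x j) ≈ℂ ofℝ 0ℝ
∑-zeroˡ {n} x = C.trans (∑C.sum-cong-≋ λ j → C.zeroˡ (x j)) (∑C.sum-replicate-zero n)

-- Induction on the row: the first row is a one followed by zeros, and a later row without its
-- leading zero is, by computation, a row of the smaller identity matrix.
Iᴹ-· : ∀ {l} (x : Vector ℂ l) → Iᴹ · x ≈ⱽ x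
Iᴹ-· x zero    = C.trans (C.+-cong (C.*-identityˡ (x zero)) (∑-zeroˡ (tail x))) (C.+-identityʳ (x zero))
Iᴹ-· x (suc i) = C.trans (C.+-cong (C.zeroˡ (x zero)) (Iᴹ-· (tail x) i)) (C.+-identityˡ (x (suc i)))

-- The scalar frieze of a unit common eigenvector

module UnitVector {l : ℕ} {x : Vector ℂ l} (unit : ⟨ x , x ⟩ ≈ℂ ofℝ 1ℝ) where
  open SetoidReasoning C.setoid

  -- Pairing with `x` recovers the scalar from a multiple of `x`, without dividing by a coordinate.
  ⟨•x,x⟩ : ∀ z → ⟨ z • x , x ⟩ ≈ℂ z
  ⟨•x,x⟩ z = C.trans (⟨•,⟩ z x x) (C.trans (C.*-congˡ unit) (C.*-identityʳ z))

  -- Pairing the eigenvector equation with `x` identifies its witness `z` with the scalar that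
  -- replaces `A`.
  eigenvalue-⟨,⟩ : ∀ {A} → IsEigenvector A x → A · x ≈ⱽ ⟨ A · x , x ⟩ • x
  eigenvalue-⟨,⟩ {A} (_ , z , Ax≈zx) i = C.trans (Ax≈zx i)
    (C.*-congʳ (C.sym (C.trans (⟨,⟩-congˡ x Ax≈zx) (⟨•x,x⟩ z))))

  -- `B` acts first and its eigenvalue is pulled out first, which puts `b` in front of `a`.
  *ᴹ-eigen : ∀ {A B a b} → A · x ≈ⱽ a • x → B · x ≈ⱽ b • x → (A *ᴹ B) · x ≈ⱽ (b *ℂ a) • x
  *ᴹ-eigen {A} {B} {a} {b} Ax Bx i = begin
    ((A *ᴹ B) · x) i   ≈⟨ *ᴹ-· A B x i ⟩
    (A · (B · x)) i    ≈⟨ ·-cong {A = A} (λ _ _ → R.refl) Bx i ⟩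
    (A · (b • x)) i    ≈⟨ ·-• A b x i ⟩
    b *ℂ (A · x) i     ≈⟨ C.*-congˡ (Ax i) ⟩
    b *ℂ (a *ℂ x i)    ≈⟨ C.*-assoc b a (x i) ⟨
    b *ℂ a *ℂ x i      ∎

  -- Applying both sides of the matrix rule to `x` gives `z • x ≈ⱽ x`; pairing this with `x` gives
  -- that `z` is one.
  eigen-rule : ∀ {A B D E a b d e} →
    A · x ≈ⱽ a • x → B · x ≈ⱽ b • x → D · x ≈ⱽ d • x → E · x ≈ⱽ e • x →
    A *ᴹ B -ᴹ D *ᴹ E ≈ᴹ Iᴹ → b *ℂ a +ℂ -ℂ (e *ℂ d) ≈ℂ ofℝ 1ℝ
  eigen-rule {A} {B} {D} {E} {a} {b} {d} {e} Ax Bx Dx Ex rule = begin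
    z               ≈⟨ ⟨•x,x⟩ z ⟨
    ⟨ z • x , x ⟩   ≈⟨ ⟨,⟩-congˡ x zx≈x ⟩
    ⟨ x , x ⟩       ≈⟨ unit ⟩
    ofℝ 1ℝ          ∎
    where
    z = b *ℂ a +ℂ -ℂ (e *ℂ d)
    zx≈x : z • x ≈ⱽ x
    zx≈x i = begin
      z *ℂ x i
        ≈⟨ RingProperties.[y-z]x≈yx-zx C.ring (x i) (b *ℂ a) (e *ℂ d) ⟩
      b *ℂ a *ℂ x i +ℂ -ℂ (e *ℂ d *ℂ x i)
        ≈⟨ C.+-cong (*ᴹ-eigen {A} {B} Ax Bx i) (C.-‿cong (*ᴹ-eigen {D} {E} Dx Ex i)) ⟨
      ((A *ᴹ B) · x) i +ℂ -ℂ ((D *ᴹ E) · x) i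
        ≈⟨ -ᴹ-· (A *ᴹ B) (D *ᴹ E) x i ⟨
      ((A *ᴹ B -ᴹ D *ᴹ E) · x) i
        ≈⟨ ·-cong rule (λ _ → C.refl) i ⟩
      (Iᴹ · x) i
        ≈⟨ Iᴹ-· x i ⟩
      x i  ∎

  module _ (p : ℕ) {M : Array (Matrix ℝ l)} (eigen : IsCommonEigenvector p M x) where
    private
      m : Array ℂ
      m = scalarArray M x

      ev : ∀ i j → InStrip p i j → M i j · x ≈ⱽ m i j • x
      ev i j s = eigenvalue-⟨,⟩ {M i j} (eigen i j s)

      entry-cong : ∀ {A B : Matrix ℝ l} → A ≈ᴹ B → ⟨ A · x , x ⟩ ≈ℂ ⟨ B · x , x ⟩
      entry-cong A≈B = ⟨,⟩-congˡ x (·-cong A≈B λ _ → C.refl)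

      entry-O : ∀ {A} → A ≈ᴹ Oᴹ → ⟨ A · x , x ⟩ ≈ℂ ofℝ 0ℝ
      entry-O A≈O = C.trans (entry-cong A≈O)
        -- The zero matrix sends `x` to the zero vector, whose pairing with `x` is again a sum with
        -- zero coefficients, now over the conjugates.
        (C.trans (⟨,⟩-congˡ x λ _ → ∑-zeroˡ x) (∑-zeroˡ (conj ∘ x)))

      entry-I : ∀ {A} → A ≈ᴹ Iᴹ → ⟨ A · x , x ⟩ ≈ℂ ofℝ 1ℝ
      entry-I A≈I = C.trans (entry-cong A≈I) (C.trans (⟨,⟩-congˡ x (Iᴹ-· x)) unit)

    UnimodularRule : Set
    UnimodularRule = ∀ i j → RuleRange p i j →
      m i j *ℂ m (ℤ.suc i) (ℤ.suc j) +ℂ -ℂ (m i (ℤ.suc j) *ℂ m (ℤ.suc i) j) ≈ℂ ofℝ 1ℝ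

    right⇒unimodular : RightRule p M → UnimodularRule
    right⇒unimodular rule i j r = eigen-rule
      {M (ℤ.suc i) (ℤ.suc j)} {M i j} {M (ℤ.suc i) j} {M i (ℤ.suc j)}
      (ev (ℤ.suc i) (ℤ.suc j) (rule-SE p i j r)) (ev i j (rule-NW p i j r))
      (ev (ℤ.suc i) j (rule-SW p i j r)) (ev i (ℤ.suc j) (rule-NE p i j r)) (rule i j r)

    left⇒unimodular : LeftRule p M → UnimodularRule
    left⇒unimodular rule i j r = C.trans
      -- `eigen-rule` reverses both products. This suits the right rule as it stands; for the left
      -- rule commutativity of `ℂ` restores the order.
      (C.+-cong (C.*-comm _ _) (C.-‿cong (C.*-comm _ _)))
      (eigen-rule
        {M i j} {M (ℤ.suc i) (ℤ.suc j)} {M i (ℤ.suc j)} {M (ℤ.suc i) j}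
        (ev i j (rule-NW p i j r)) (ev (ℤ.suc i) (ℤ.suc j) (rule-SE p i j r))
        (ev i (ℤ.suc j) (rule-NE p i j r)) (ev (ℤ.suc i) j (rule-SW p i j r)) (rule i j r))

    scalar-frieze : IsMatrixArray p M → UnimodularRule → IsScalarFrieze p m
    scalar-frieze isArray unimodular = record
      { periodic   = λ i j s → entry-cong (periodic i j s)
      ; first-0    = λ i → entry-O (first-O i)
      ; last-0     = λ i → entry-O (last-O i)
      ; first-1    = λ i → entry-I (first-I i)
      ; last-1     = λ i → entry-I (last-I i)
      ; unimodular = unimodular
      }
      where open IsMatrixArray isArray

    frieze⇒scalar-frieze : IsMatrixFrieze p M → IsScalarFrieze p m
    frieze⇒scalar-frieze (inj₁ (isArray , left))  = scalar-frieze isArray (left⇒unimodular left)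
    frieze⇒scalar-frieze (inj₂ (isArray , right)) = scalar-frieze isArray (right⇒unimodular right)

‖‖≡1⇒unit : ∀ {l} {x : Vector ℂ l} → ‖ x ‖≡ 1ℝ → ⟨ x , x ⟩ ≈ℂ ofℝ 1ℝ
‖‖≡1⇒unit (_ , 1*1≈⟨x,x⟩) = C.trans (C.sym 1*1≈⟨x,x⟩) (ofℝ-cong (R.*-identityˡ 1ℝ))

proposition40 : (l p : ℕ) (M : Array (Matrix ℝ l)) → IsMatrixFrieze p M →
    (IsMatrixFrieze p (transposeNonTrivial p M)
    × (IsRightFrieze p M → IsLeftFrieze p (transposeNonTrivial p M))
    × (IsTwoSidedFrieze p M → IsTwoSidedFrieze p (transposeNonTrivial p M)))
    × (EntriesCommute p M → (x : Vector ℂ l) → ‖ x ‖≡ 1ℝ → IsCommonEigenvector p M x →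
    IsScalarFrieze p (scalarArray M x))
proposition40 l p M frieze =
  -- Transposition changes sides, so the injections are swapped here, and below each half of a
  -- two-sided frieze supplies the other half of its transpose.
  ( [ inj₂ ∘ transpose-left p , inj₁ ∘ transpose-right p ]′ frieze
  , transpose-right p
  , λ (left , right) → transpose-right p right , transpose-left p left )
  , λ _ x unit eigen → UnitVector.frieze⇒scalar-frieze {x = x} (‖‖≡1⇒unit {x = x} unit) p eigen frieze
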